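{- There is an infinite binary tree $T\subseteq 2^{<\omega}$ that is computable but does not have a computable branch.
   Context: $2^{<\omega}$ is the set of finite sequences with entries from $\{0,1\}$; $\sigma\sqsubset\tau$ means that $\sigma$ is a proper initial segment of $\tau$. A binary tree is a nonempty set $T\subseteq 2^{<\omega}$ such that $\sigma\sqsubset\tau\in T$ entails $\sigma\in T$. A branch of $T$ is a function $f:\mathbb N\to\{0,1\}$ with $\langle f(0),\ldots,f(n-1)\rangle\in T$ for all $n\in\mathbb N$. Via a fixed primitive recursive coding of finite sequences of natural numbers by natural numbers, a tree is viewed as a subset of $\mathbb N$; a set is computable if its characteristic function is computable. -}

module Defs where

open import Data.Fin.Base using (Fin; toℕ)
open import Data.List.Base using (List; []; _∷_; map; applyUpTo)
import Data.List.Membership.Propositional as List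
open import Data.List.Relation.Binary.Prefix.Heterogeneous using (Prefix)
open import Data.Nat.Base using (ℕ; zero; suc; _+_; _<_)
open import Data.Product.Base using (∃; _×_)
open import Data.Sum.Base using (_⊎_)
open import Data.Vec.Base using (Vec; []; _∷_; lookup)
open import Data.Vec.Relation.Binary.Pointwise.Inductive using (Pointwise)
open import Level using (0ℓ)
open import Relation.Binary.PropositionalEquality using (_≡_; _≢_)
open import Relation.Unary using (Pred; _∈_; _∉_; Satisfiable)

-- Syntax of the partial recursive (μ-recursive) functions ℕⁿ ⇀ ℕ.
data Rec : ℕ → Set where
  zeroᶠ : ∀ {n} → Rec n
  sucᶠ  : Rec 1
  proj  : ∀ {n} → Fin n → Rec n
  comp  : ∀ {m n} → Rec m → Vec (Rec n) m → Rec n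
  prec  : ∀ {n} → Rec n → Rec (2 + n) → Rec (suc n)
  min   : ∀ {n} → Rec (suc n) → Rec n

-- p ⟦ xs ⟧⇓ y : the partial function p is defined at xs, with value y.
infix 4 _⟦_⟧⇓_

data _⟦_⟧⇓_ : ∀ {n} → Rec n → Vec ℕ n → ℕ → Set where
  zero⇓  : ∀ {n} {xs : Vec ℕ n} → zeroᶠ ⟦ xs ⟧⇓ 0
  suc⇓   : ∀ {x} → sucᶠ ⟦ x ∷ [] ⟧⇓ suc x
  proj⇓  : ∀ {n} {i : Fin n} {xs} → proj i ⟦ xs ⟧⇓ lookup xs i
  comp⇓  : ∀ {m n} {g : Rec m} {hs : Vec (Rec n) m} {xs ys z} →
           Pointwise (λ h y → h ⟦ xs ⟧⇓ y) hs ys →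
           g ⟦ ys ⟧⇓ z →
           comp g hs ⟦ xs ⟧⇓ z
  -- The recursion argument comes first; the step function receives the
  -- recursion argument, the previous value and the parameters.
  prec⇓₀ : ∀ {n} {g : Rec n} {h xs y} →
           g ⟦ xs ⟧⇓ y →
           prec g h ⟦ 0 ∷ xs ⟧⇓ y
  prec⇓₊ : ∀ {n} {g : Rec n} {h xs k y z} →
           prec g h ⟦ k ∷ xs ⟧⇓ y →
           h ⟦ k ∷ y ∷ xs ⟧⇓ z →
           prec g h ⟦ suc k ∷ xs ⟧⇓ z
  -- Defined at xs only if p is defined and nonzero at all arguments below
  -- the first zero.
  min⇓   : ∀ {n} {p : Rec (suc n)} {xs y} →
           (∀ i → i < y → ∃ λ k → p ⟦ i ∷ xs ⟧⇓ suc k) →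
           p ⟦ y ∷ xs ⟧⇓ 0 →
           min p ⟦ xs ⟧⇓ y

Computable : (ℕ → ℕ) → Set
Computable f = ∃ λ (p : Rec 1) → ∀ n → p ⟦ n ∷ [] ⟧⇓ f n

IsCharacteristic : (ℕ → ℕ) → Pred ℕ 0ℓ → Set
IsCharacteristic χ A = ∀ n → (n ∈ A × χ n ≡ 1) ⊎ (n ∉ A × χ n ≡ 0)

ComputableSet : Pred ℕ 0ℓ → Set
ComputableSet A = ∃ λ χ → IsCharacteristic χ A × Computable χ

-- Cantor pairing: pair x y = (x + y)(x + y + 1)/2 + y.
triangle : ℕ → ℕ
triangle zero    = 0
triangle (suc n) = suc n + triangle n

pair : ℕ → ℕ → ℕ
pair x y = triangle (x + y) + y

code : List ℕ → ℕ
code []       = 0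
code (x ∷ xs) = suc (pair x (code xs))

2^<ω : Set
2^<ω = List (Fin 2)

infix 4 _⊏_

_⊏_ : 2^<ω → 2^<ω → Set
σ ⊏ τ = Prefix _≡_ σ τ × σ ≢ τ

record IsBinaryTree (T : Pred 2^<ω 0ℓ) : Set where
  field
    nonempty : Satisfiable T
    closed   : ∀ {σ τ} → σ ⊏ τ → τ ∈ T → σ ∈ T

-- Infinitude in positive form: no finite list exhausts P.  Classically this
-- is the same as P not being finite.
Infinite : ∀ {A : Set} → Pred A 0ℓ → Set
Infinite P = ∀ xs → ∃ λ x → x ∈ P × x List.∉ xs

IsBranch : Pred 2^<ω 0ℓ → (ℕ → Fin 2) → Set
IsBranch T f = ∀ n → applyUpTo f n ∈ T

asSubsetOfℕ : Pred 2^<ω 0ℓ → Pred ℕ 0ℓ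
asSubsetOfℕ T n = ∃ λ σ → σ ∈ T × code (map toℕ σ) ≡ n

ComputableTree : Pred 2^<ω 0ℓ → Set
ComputableTree T = ComputableSet (asSubsetOfℕ T)

ComputableBranch : Pred 2^<ω 0ℓ → (ℕ → Fin 2) → Set
ComputableBranch T f = IsBranch T f × Computable (λ n → toℕ (f n))

{-# OPTIONS --safe #-}
module Submission where

-- Diagonalization in the style of Kleene: a branch must disagree at e with the value that the
-- program e returns on e, so it is not computed by any program, while a single node only has to
-- disagree with the finitely many values returned within a number of steps bounded by its length.
-- Deciding this needs the computations to be simulated by a recursive function: the partial
-- recursive functions are compiled into while programs coded by numbers, whose configurations
-- (a stack of commands and a stack of data, also coded by one number) evolve by a recursive step
-- function.  Only the completeness of the compilation is needed, since nothing depends on what a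
-- number that is not the code of a compiled program does.

open import Defs
open import Data.Fin.Base using (Fin; zero; suc; toℕ)
open import Data.Fin.Patterns using (0F; 1F; 2F; 3F)
open import Data.List.Base using (List; []; _∷_; map; length; applyUpTo; applyDownFrom)
open import Data.List.Extrema.Nat using (max; xs≤max)
open import Data.List.Membership.Propositional.Properties using (∈-map⁺)
open import Data.List.Properties using (map-applyUpTo; length-applyUpTo)
open import Data.List.Relation.Binary.Prefix.Heterogeneous using (Prefix; []; _∷_)
open import Data.List.Relation.Unary.All as All using (All; []; _∷_)
open import Data.Nat.Base
open import Data.Nat.GeneralisedArithmetic using (fold; fold-+)
open import Data.Nat.Induction using (<-rec)
open import Data.Nat.ListAction using (sum)
open import Data.Nat.Properties
open import Data.Product.Base using (∃; ∃₂; _×_; _,_)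
open import Data.Sum.Base using (inj₁; inj₂)
open import Data.Vec.Base using (Vec; []; _∷_; lookup)
open import Data.Vec.Relation.Binary.Pointwise.Inductive using (Pointwise; []; _∷_)
open import Function.Base using (id)
open import Level using (0ℓ)
open import Relation.Binary.PropositionalEquality
open import Relation.Nullary.Decidable using (yes; no)
open import Relation.Nullary.Negation.Core using (¬_; contradiction)
open import Relation.Unary using (Pred; _∈_)

-- Closure properties of the total recursive functions

Recursive : ∀ {n} → (Vec ℕ n → ℕ) → Set
Recursive {n} f = ∃ λ (p : Rec n) → ∀ xs → p ⟦ xs ⟧⇓ f xs

-- Stated as closure under substitution in every arity, so that a proof of recursiveness follows the
-- shape of the term defining the function.
Recursive₁ : (ℕ → ℕ) → Set
Recursive₁ f = ∀ {n} {a : Vec ℕ n → ℕ} → Recursive a → Recursive (λ xs → f (a xs))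

Recursive₂ : (ℕ → ℕ → ℕ) → Set
Recursive₂ f = ∀ {n} {a b : Vec ℕ n → ℕ} →
  Recursive a → Recursive b → Recursive (λ xs → f (a xs) (b xs))

Recursive₃ : (ℕ → ℕ → ℕ → ℕ) → Set
Recursive₃ f = ∀ {n} {a b c : Vec ℕ n → ℕ} →
  Recursive a → Recursive b → Recursive c → Recursive (λ xs → f (a xs) (b xs) (c xs))

var : ∀ {n} (i : Fin n) → Recursive (λ xs → lookup xs i)
var i = proj i , λ _ → proj⇓

substitute₁ : ∀ {f} → Recursive {1} (λ xs → f (lookup xs 0F)) → Recursive₁ f
substitute₁ (p , p⇓) (q , q⇓) = comp p (q ∷ []) , λ xs → comp⇓ (q⇓ xs ∷ []) (p⇓ (_ ∷ []))

substitute₂ : ∀ {f} → Recursive {2} (λ xs → f (lookup xs 0F) (lookup xs 1F)) → Recursive₂ f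
substitute₂ (p , p⇓) (q , q⇓) (r , r⇓) =
  comp p (q ∷ r ∷ []) , λ xs → comp⇓ (q⇓ xs ∷ r⇓ xs ∷ []) (p⇓ (_ ∷ _ ∷ []))

substitute₃ : ∀ {f} → Recursive {3} (λ xs → f (lookup xs 0F) (lookup xs 1F) (lookup xs 2F)) →
              Recursive₃ f
substitute₃ (p , p⇓) (q , q⇓) (r , r⇓) (s , s⇓) =
  comp p (q ∷ r ∷ s ∷ []) ,
  λ xs → comp⇓ (q⇓ xs ∷ r⇓ xs ∷ s⇓ xs ∷ []) (p⇓ (_ ∷ _ ∷ _ ∷ []))

primitiveRecursion : ∀ {n h} {f : Vec ℕ (suc n) → ℕ} →
                     Recursive (λ xs → f (0 ∷ xs)) → Recursive h →
                     (∀ k xs → h (k ∷ f (k ∷ xs) ∷ xs) ≡ f (suc k ∷ xs)) →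
                     Recursive f
primitiveRecursion {h = h} {f} (p , p⇓) (q , q⇓) step≡ = prec p q , run
  where
  run : ∀ xs → prec p q ⟦ xs ⟧⇓ f xs
  run (zero  ∷ xs) = prec⇓₀ (p⇓ xs)
  run (suc k ∷ xs) = subst (_ ⟦ _ ⟧⇓_) (step≡ k xs) (prec⇓₊ (run (k ∷ xs)) (q⇓ _))

suc-recursive : Recursive₁ suc
suc-recursive = substitute₁ {suc} (sucᶠ , λ { (_ ∷ []) → suc⇓ })

const-recursive : ∀ {n} k → Recursive {n} (λ _ → k)
const-recursive zero    = zeroᶠ , λ _ → zero⇓
const-recursive (suc k) = suc-recursive (const-recursive k)

pred-recursive : Recursive₁ pred
pred-recursive = substitute₁ {pred}
  (primitiveRecursion (const-recursive 0) (var 0F) (λ _ _ → refl))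

+-recursive : Recursive₂ _+_
+-recursive = substitute₂ {_+_}
  (primitiveRecursion (var 0F) (suc-recursive (var 1F)) (λ { _ (_ ∷ []) → refl }))

∸-recursive : Recursive₂ _∸_
-- Truncated subtraction recurses on the subtrahend, so the arguments are exchanged.
∸-recursive a b = substitute₂ {λ n m → m ∸ n}
  (primitiveRecursion (var 0F) (pred-recursive (var 1F))
    (λ { k (m ∷ []) → pred[m∸n]≡m∸[1+n] m k }))
  b a

ifz : ℕ → ℕ → ℕ → ℕ
ifz zero    x y = x
ifz (suc _) x y = y

ifz-zero : ∀ {z x y} → z ≡ 0 → ifz z x y ≡ x
ifz-zero refl = refl

ifz-suc : ∀ {z k x y} → z ≡ suc k → ifz z x y ≡ y
ifz-suc refl = refl

ifz-recursive : Recursive₃ ifz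
ifz-recursive = substitute₃ {ifz}
  (primitiveRecursion (var 0F) (var 3F) (λ { _ (_ ∷ _ ∷ []) → refl }))

fold-recursive : ∀ s → Recursive₁ s → Recursive₂ (λ z n → fold z s n)
fold-recursive s s-recursive a b = substitute₂ {λ n z → fold z s n}
  (primitiveRecursion (var 0F) (s-recursive (var 1F)) (λ { _ (_ ∷ []) → refl }))
  b a

sum-recursive : ∀ f → Recursive₂ f → Recursive₂ (λ n x → sum (applyDownFrom (f x) n))
sum-recursive f f-recursive = substitute₂ {λ n x → sum (applyDownFrom (f x) n)}
  (primitiveRecursion (const-recursive 0)
    (+-recursive (f-recursive (var 2F) (var 0F)) (var 1F)) (λ { _ (_ ∷ []) → refl }))

-- An index beyond the list acts as the identity, so ill-formed commands need no separate treatment.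
select : List (ℕ → ℕ) → ℕ → ℕ → ℕ
select []       _ x = x
select (f ∷ fs) t x = ifz t (f x) (select fs (pred t) x)

select-recursive : ∀ {fs} → All Recursive₁ fs → Recursive₂ (select fs)
select-recursive []       a b = b
select-recursive (r ∷ rs) a b = ifz-recursive a (r b) (select-recursive rs (pred-recursive a) b)

-- Inverting the Cantor pairing

triangle-recursive : Recursive₁ triangle
triangle-recursive = substitute₁ {triangle} (primitiveRecursion (const-recursive 0)
  (+-recursive (suc-recursive (var 0F)) (var 1F)) (λ { _ [] → refl }))

m≤triangle : ∀ m → m ≤ triangle m
m≤triangle zero    = z≤n
m≤triangle (suc m) = m≤m+n (suc m) (triangle m)

-- The largest w with triangle w ≤ z.
root : ℕ → ℕ
root zero    = 0
root (suc z) = root z + (1 ∸ (triangle (suc (root z)) ∸ suc z))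

root-recursive : Recursive₁ root
root-recursive = substitute₁ {root} (primitiveRecursion (const-recursive 0)
  (+-recursive (var 1F) (∸-recursive (const-recursive 1)
    (∸-recursive (triangle-recursive (suc-recursive (var 1F))) (suc-recursive (var 0F)))))
  (λ { _ [] → refl }))

-- Along a diagonal the next triangular number, `triangle n + n + 1`, is not reached while `y ≤ n`,
-- so `root` stays put; passing from the end of diagonal `n` to the next one raises it by 1.
root-triangle+ : ∀ n y → y ≤ n → root (triangle n + y) ≡ n
root-triangle+ zero    zero    _   = refl
root-triangle+ (suc n) zero    _
  rewrite +-identityʳ (n + triangle n) | +-comm n (triangle n)
        | root-triangle+ n n ≤-refl | +-comm n (triangle n)
        | n∸n≡0 (triangle n + n) = +-comm n 1
root-triangle+ n       (suc y) y<n
  rewrite +-suc (triangle n) y | root-triangle+ n y (<⇒≤ y<n)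
        | +-comm n (triangle n) | [m+n]∸[m+o]≡n∸o (triangle n) n y
  with n ∸ y | m<n⇒0<n∸m y<n
... | suc d | _ rewrite 0∸n≡0 d = +-identityʳ n

-- The successor moves one place along a diagonal, or from its end to the start of the next
-- diagonal.
pair-surjective : ∀ z → ∃₂ λ x y → pair x y ≡ z
pair-surjective zero = 0 , 0 , refl
pair-surjective (suc z) with pair-surjective z
... | zero  , y , refl = suc y , 0 ,
  trans (+-identityʳ _) (trans (cong (λ n → triangle (suc n)) (+-identityʳ y))
    (cong suc (+-comm y (triangle y))))
... | suc x , y , refl = x , suc y ,
  trans (cong (λ n → triangle n + suc y) (+-suc x y)) (+-suc _ y)

-- Sealed so that coded configurations stay symbolic; only the laws in this block are used
-- afterwards.
opaque
  ⟨_,_⟩ : ℕ → ℕ → ℕ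
  ⟨_,_⟩ = pair

  π₁ π₂ : ℕ → ℕ
  π₂ z = z ∸ triangle (root z)
  π₁ z = root z ∸ π₂ z

  ⟨,⟩≡pair : ∀ x y → ⟨ x , y ⟩ ≡ pair x y
  ⟨,⟩≡pair _ _ = refl

  π₂-⟨,⟩ : ∀ x y → π₂ ⟨ x , y ⟩ ≡ y
  π₂-⟨,⟩ x y rewrite root-triangle+ (x + y) y (m≤n+m y x) = m+n∸m≡n (triangle (x + y)) y

  π₁-⟨,⟩ : ∀ x y → π₁ ⟨ x , y ⟩ ≡ x
  π₁-⟨,⟩ x y = trans (cong₂ _∸_ (root-triangle+ (x + y) y (m≤n+m y x)) (π₂-⟨,⟩ x y)) (m+n∸n≡m x y)

  ⟨π₁,π₂⟩ : ∀ z → ⟨ π₁ z , π₂ z ⟩ ≡ z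
  ⟨π₁,π₂⟩ z with pair-surjective z
  ... | x , y , refl = cong₂ pair (π₁-⟨,⟩ x y) (π₂-⟨,⟩ x y)

  x≤⟨x,y⟩ : ∀ x y → x ≤ ⟨ x , y ⟩
  x≤⟨x,y⟩ x y = ≤-trans (m≤m+n x y) (≤-trans (m≤triangle (x + y)) (m≤m+n _ y))

  y≤⟨x,y⟩ : ∀ x y → y ≤ ⟨ x , y ⟩
  y≤⟨x,y⟩ x y = m≤n+m y _

  ⟨,⟩-recursive : Recursive₂ ⟨_,_⟩
  ⟨,⟩-recursive a b = +-recursive (triangle-recursive (+-recursive a b)) b

  π₂-recursive : Recursive₁ π₂
  π₂-recursive a = ∸-recursive a (triangle-recursive (root-recursive a))

  π₁-recursive : Recursive₁ π₁
  π₁-recursive a = ∸-recursive (root-recursive a) (π₂-recursive a)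

π₁≡ : ∀ {z x y} → z ≡ ⟨ x , y ⟩ → π₁ z ≡ x
π₁≡ refl = π₁-⟨,⟩ _ _

π₂≡ : ∀ {z x y} → z ≡ ⟨ x , y ⟩ → π₂ z ≡ y
π₂≡ refl = π₂-⟨,⟩ _ _

infixr 4 _,≡_

_,≡_ : ∀ {x x′ y y′} → x ≡ x′ → y ≡ y′ → ⟨ x , y ⟩ ≡ ⟨ x′ , y′ ⟩
_,≡_ = cong₂ ⟨_,_⟩

π₁≤ : ∀ z → π₁ z ≤ z
π₁≤ z = subst (π₁ z ≤_) (⟨π₁,π₂⟩ z) (x≤⟨x,y⟩ (π₁ z) (π₂ z))

π₂≤ : ∀ z → π₂ z ≤ z
π₂≤ z = subst (π₂ z ≤_) (⟨π₁,π₂⟩ z) (y≤⟨x,y⟩ (π₁ z) (π₂ z))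

-- A universal machine

-- A machine state ⟨ K , v ⟩ is a stack K = ⟨ c₁ , ⟨ c₂ , … ⟩ ⟩ of commands still to be executed
-- and a stack v of data.  A command is a pair ⟨ tag , argument ⟩; any command with tag 0 halts.
-- A while loop tests the second item of the data stack, leaving the top to the value computed.
halted : ℕ
halted = ⟨ ⟨ 0 , 0 ⟩ , 0 ⟩

infixr 5 _﹔_

_﹔_ : ℕ → ℕ → ℕ
c ﹔ d = ⟨ 1 , ⟨ c , d ⟩ ⟩

while : ℕ → ℕ
while c = ⟨ 2 , c ⟩

instr : ℕ → ℕ
instr i = ⟨ 3 , i ⟩

zeroTop sucTop headTop tailTop dup swap consTop : ℕ → ℕ
zeroTop v = ⟨ 0 , π₂ v ⟩
sucTop  v = ⟨ suc (π₁ (π₁ v)) , π₂ v ⟩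
headTop v = ⟨ π₁ (π₁ v) , π₂ v ⟩
tailTop v = ⟨ π₂ (π₁ v) , π₂ v ⟩
dup     v = ⟨ π₁ v , v ⟩
swap    v = ⟨ π₁ (π₂ v) , ⟨ π₁ v , π₂ (π₂ v) ⟩ ⟩
consTop v = ⟨ ⟨ π₁ v , π₁ (π₂ v) ⟩ , π₂ (π₂ v) ⟩

-- At each loop test the stack holds, for primitive recursion, the current value, the number of
-- remaining rounds, and the index paired with the parameters; for minimization, the index, the
-- value of the function there, and the parameters. `finish` keeps the top and drops the next two
-- items.
precInit precBody minInit minBody finish : ℕ → ℕ
precInit v = ⟨ π₂ (π₁ v) , ⟨ π₁ (π₁ v) , ⟨ ⟨ 0 , π₂ (π₁ v) ⟩ , π₂ v ⟩ ⟩ ⟩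
precBody v =
  ⟨ ⟨ π₁ (π₁ (π₂ (π₂ v))) , ⟨ π₁ v , π₂ (π₁ (π₂ (π₂ v))) ⟩ ⟩ ,
  ⟨ pred (π₁ (π₂ v)) ,
  ⟨ ⟨ suc (π₁ (π₁ (π₂ (π₂ v)))) , π₂ (π₁ (π₂ (π₂ v))) ⟩ , π₂ (π₂ (π₂ v)) ⟩ ⟩ ⟩
minInit v = ⟨ ⟨ 0 , π₁ v ⟩ , ⟨ 0 , v ⟩ ⟩
minBody v = ⟨ ⟨ suc (π₁ v) , π₁ (π₂ (π₂ v)) ⟩ , ⟨ suc (π₁ v) , π₂ (π₂ v) ⟩ ⟩
finish v = ⟨ π₁ v , π₂ (π₂ (π₂ v)) ⟩

instructions : List (ℕ → ℕ)
instructions =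
  zeroTop ∷ sucTop ∷ headTop ∷ tailTop ∷ dup ∷ swap ∷ consTop ∷
  precInit ∷ precBody ∷ minInit ∷ minBody ∷ finish ∷ []

ZERO SUC HEAD TAIL DUP SWAP CONS PREC-INIT PREC-BODY MIN-INIT MIN-BODY FINISH : ℕ
ZERO      = instr 0
SUC       = instr 1
HEAD      = instr 2
TAIL      = instr 3
DUP       = instr 4
SWAP      = instr 5
CONS      = instr 6
PREC-INIT = instr 7
PREC-BODY = instr 8
MIN-INIT  = instr 9
MIN-BODY  = instr 10
FINISH    = instr 11

tag arg rest : ℕ → ℕ
tag  st = π₁ (π₁ (π₁ st))
arg  st = π₂ (π₁ (π₁ st))
rest st = π₂ (π₁ st)

stepSeq stepWhile stepInstr : ℕ → ℕ
stepSeq   st = ⟨ ⟨ π₁ (arg st) , ⟨ π₂ (arg st) , rest st ⟩ ⟩ , π₂ st ⟩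
-- If the test is nonzero, the body goes in front of the whole command stack, loop included, so the
-- test is repeated after it.
stepWhile st = ⟨ ifz (π₁ (π₂ (π₂ st))) (rest st) ⟨ arg st , π₁ st ⟩ , π₂ st ⟩
stepInstr st = ⟨ rest st , select instructions (arg st) (π₂ st) ⟩

handlers : List (ℕ → ℕ)
handlers = id ∷ stepSeq ∷ stepWhile ∷ stepInstr ∷ []

step : ℕ → ℕ
step st = select handlers (tag st) st

-- Recursiveness of the step function

instructions-recursive : All Recursive₁ instructions
instructions-recursive =
  (λ v → ⟨,⟩-recursive (const-recursive 0) (#2 v)) ∷
  (λ v → ⟨,⟩-recursive (suc-recursive (#1 (#1 v))) (#2 v)) ∷
  (λ v → ⟨,⟩-recursive (#1 (#1 v)) (#2 v)) ∷
  (λ v → ⟨,⟩-recursive (#2 (#1 v)) (#2 v)) ∷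
  (λ v → ⟨,⟩-recursive (#1 v) v) ∷
  (λ v → ⟨,⟩-recursive (#1 (#2 v)) (⟨,⟩-recursive (#1 v) (#2 (#2 v)))) ∷
  (λ v → ⟨,⟩-recursive (⟨,⟩-recursive (#1 v) (#1 (#2 v))) (#2 (#2 v))) ∷
  (λ v → ⟨,⟩-recursive (#2 (#1 v)) (⟨,⟩-recursive (#1 (#1 v))
    (⟨,⟩-recursive (⟨,⟩-recursive (const-recursive 0) (#2 (#1 v))) (#2 v)))) ∷
  (λ v → ⟨,⟩-recursive
    (⟨,⟩-recursive (#1 (#1 (#2 (#2 v)))) (⟨,⟩-recursive (#1 v) (#2 (#1 (#2 (#2 v))))))
    (⟨,⟩-recursive (pred-recursive (#1 (#2 v)))
      (⟨,⟩-recursive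
        (⟨,⟩-recursive (suc-recursive (#1 (#1 (#2 (#2 v))))) (#2 (#1 (#2 (#2 v)))))
        (#2 (#2 (#2 v)))))) ∷
  (λ v → ⟨,⟩-recursive (⟨,⟩-recursive (const-recursive 0) (#1 v))
    (⟨,⟩-recursive (const-recursive 0) v)) ∷
  (λ v → ⟨,⟩-recursive (⟨,⟩-recursive (suc-recursive (#1 v)) (#1 (#2 (#2 v))))
    (⟨,⟩-recursive (suc-recursive (#1 v)) (#2 (#2 v)))) ∷
  (λ v → ⟨,⟩-recursive (#1 v) (#2 (#2 (#2 v)))) ∷ []
  where
  #1 : Recursive₁ π₁
  #1 = π₁-recursive
  #2 : Recursive₁ π₂
  #2 = π₂-recursive

step-recursive : Recursive₁ step
step-recursive st = select-recursive {handlers}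
  ( (λ st → st)
  ∷ (λ st → ⟨,⟩-recursive
      (⟨,⟩-recursive (π₁-recursive (arg-recursive st))
        (⟨,⟩-recursive (π₂-recursive (arg-recursive st)) (rest-recursive st)))
      (π₂-recursive st))
  ∷ (λ st → ⟨,⟩-recursive
      (ifz-recursive (π₁-recursive (π₂-recursive (π₂-recursive st)))
        (rest-recursive st) (⟨,⟩-recursive (arg-recursive st) (π₁-recursive st)))
      (π₂-recursive st))
  ∷ (λ st → ⟨,⟩-recursive (rest-recursive st)
      (select-recursive instructions-recursive (arg-recursive st) (π₂-recursive st)))
  ∷ [])
  (π₁-recursive (π₁-recursive (π₁-recursive st))) st
  where
  arg-recursive : Recursive₁ arg
  arg-recursive st = π₂-recursive (π₁-recursive (π₁-recursive st))
  rest-recursive : Recursive₁ rest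
  rest-recursive st = π₂-recursive (π₁-recursive st)

-- Execution of single commands

infix 4 _↝_

_↝_ : ℕ → ℕ → Set
st ↝ st′ = ∃ λ n → fold st step n ≡ st′

↝-trans : ∀ {st st′ st″} → st ↝ st′ → st′ ↝ st″ → st ↝ st″
↝-trans {st} (m , refl) (n , q) = n + m , trans (fold-+ st step n) q

-- Quantifying over the remaining commands `K` lets a subprogram run in front of any continuation,
-- which is what sequencing and loops require.
Exec : ℕ → ℕ → ℕ → Set
Exec c v w = ∀ K → ⟨ ⟨ c , K ⟩ , v ⟩ ↝ ⟨ K , w ⟩

step-tag : ∀ {t a K v} → step ⟨ ⟨ ⟨ t , a ⟩ , K ⟩ , v ⟩ ≡ select handlers t ⟨ ⟨ ⟨ t , a ⟩ , K ⟩ , v ⟩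
step-tag {t} {a} {K} {v} =
  cong (λ n → select handlers n ⟨ ⟨ ⟨ t , a ⟩ , K ⟩ , v ⟩) (π₁≡ (π₁≡ (π₁≡ refl)))

exec-seq : ∀ {c d u v w} → Exec c u v → Exec d v w → Exec (c ﹔ d) u w
exec-seq p q K = ↝-trans (1 , trans step-tag
    ((π₁≡ arg≡ ,≡ π₂≡ arg≡ ,≡ π₂≡ (π₁≡ refl)) ,≡ π₂≡ refl))
  (↝-trans (p _) (q K))
  where
  arg≡ : ∀ {t a K v} → arg ⟨ ⟨ ⟨ t , a ⟩ , K ⟩ , v ⟩ ≡ a
  arg≡ = π₂≡ (π₁≡ (π₁≡ refl))

exec-while-stop : ∀ {c x s} → Exec (while c) ⟨ x , ⟨ 0 , s ⟩ ⟩ ⟨ x , ⟨ 0 , s ⟩ ⟩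
exec-while-stop K = 1 , trans step-tag
  (trans (ifz-zero (π₁≡ (π₂≡ (π₂≡ refl)))) (π₂≡ (π₁≡ refl)) ,≡ π₂≡ refl)

exec-while-loop : ∀ {c x k s v w} → Exec c ⟨ x , ⟨ suc k , s ⟩ ⟩ v → Exec (while c) v w →
                  Exec (while c) ⟨ x , ⟨ suc k , s ⟩ ⟩ w
exec-while-loop p q K = ↝-trans (1 , trans step-tag
    (trans (ifz-suc (π₁≡ (π₂≡ (π₂≡ refl))))
      (π₂≡ (π₁≡ (π₁≡ refl)) ,≡ π₁≡ refl) ,≡ π₂≡ refl))
  (↝-trans (p _) (q K))

exec-instr : ∀ {i v w} → select instructions i v ≡ w → Exec (instr i) v w
exec-instr eq K = 1 , trans step-tag
  (π₂≡ (π₁≡ refl) ,≡ trans (cong₂ (select instructions) (π₂≡ (π₁≡ (π₁≡ refl))) (π₂≡ refl)) eq)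

exec-ZERO : ∀ {x s} → Exec ZERO ⟨ x , s ⟩ ⟨ 0 , s ⟩
exec-ZERO = exec-instr (refl ,≡ π₂≡ refl)

exec-SUC : ∀ {x l s} → Exec SUC ⟨ ⟨ x , l ⟩ , s ⟩ ⟨ suc x , s ⟩
exec-SUC = exec-instr (cong suc (π₁≡ (π₁≡ refl)) ,≡ π₂≡ refl)

exec-HEAD : ∀ {x l s} → Exec HEAD ⟨ ⟨ x , l ⟩ , s ⟩ ⟨ x , s ⟩
exec-HEAD = exec-instr (π₁≡ (π₁≡ refl) ,≡ π₂≡ refl)

exec-TAIL : ∀ {x l s} → Exec TAIL ⟨ ⟨ x , l ⟩ , s ⟩ ⟨ l , s ⟩
exec-TAIL = exec-instr (π₂≡ (π₁≡ refl) ,≡ π₂≡ refl)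

exec-DUP : ∀ {x s} → Exec DUP ⟨ x , s ⟩ ⟨ x , ⟨ x , s ⟩ ⟩
exec-DUP = exec-instr (π₁≡ refl ,≡ refl)

exec-SWAP : ∀ {x y s} → Exec SWAP ⟨ x , ⟨ y , s ⟩ ⟩ ⟨ y , ⟨ x , s ⟩ ⟩
exec-SWAP = exec-instr (π₁≡ (π₂≡ refl) ,≡ π₁≡ refl ,≡ π₂≡ (π₂≡ refl))

exec-CONS : ∀ {x y s} → Exec CONS ⟨ x , ⟨ y , s ⟩ ⟩ ⟨ ⟨ x , y ⟩ , s ⟩
exec-CONS = exec-instr ((π₁≡ refl ,≡ π₁≡ (π₂≡ refl)) ,≡ π₂≡ (π₂≡ refl))

exec-PREC-INIT : ∀ {k l s} →
  Exec PREC-INIT ⟨ ⟨ k , l ⟩ , s ⟩ ⟨ l , ⟨ k , ⟨ ⟨ 0 , l ⟩ , s ⟩ ⟩ ⟩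
exec-PREC-INIT = exec-instr
  (π₂≡ (π₁≡ refl) ,≡ π₁≡ (π₁≡ refl) ,≡ (refl ,≡ π₂≡ (π₁≡ refl)) ,≡ π₂≡ refl)

exec-PREC-BODY : ∀ {y r i l s} →
  Exec PREC-BODY ⟨ y , ⟨ suc r , ⟨ ⟨ i , l ⟩ , s ⟩ ⟩ ⟩
    ⟨ ⟨ i , ⟨ y , l ⟩ ⟩ , ⟨ r , ⟨ ⟨ suc i , l ⟩ , s ⟩ ⟩ ⟩
exec-PREC-BODY = exec-instr
  ((π₁≡ il≡ ,≡ π₁≡ refl ,≡ π₂≡ il≡) ,≡ cong pred (π₁≡ (π₂≡ refl)) ,≡
   (cong suc (π₁≡ il≡) ,≡ π₂≡ il≡) ,≡ π₂≡ (π₂≡ (π₂≡ refl)))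
  where
  il≡ : ∀ {y r il s} → π₁ (π₂ (π₂ ⟨ y , ⟨ r , ⟨ il , s ⟩ ⟩ ⟩)) ≡ il
  il≡ = π₁≡ (π₂≡ (π₂≡ refl))

exec-MIN-INIT : ∀ {l s} → Exec MIN-INIT ⟨ l , s ⟩ ⟨ ⟨ 0 , l ⟩ , ⟨ 0 , ⟨ l , s ⟩ ⟩ ⟩
exec-MIN-INIT = exec-instr ((refl ,≡ π₁≡ refl) ,≡ refl)

exec-MIN-BODY : ∀ {i z l s} →
  Exec MIN-BODY ⟨ i , ⟨ z , ⟨ l , s ⟩ ⟩ ⟩ ⟨ ⟨ suc i , l ⟩ , ⟨ suc i , ⟨ l , s ⟩ ⟩ ⟩
exec-MIN-BODY = exec-instr
  ((cong suc (π₁≡ refl) ,≡ π₁≡ (π₂≡ (π₂≡ refl))) ,≡ cong suc (π₁≡ refl) ,≡ π₂≡ (π₂≡ refl))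

exec-FINISH : ∀ {x y z s} → Exec FINISH ⟨ x , ⟨ y , ⟨ z , s ⟩ ⟩ ⟩ ⟨ x , s ⟩
exec-FINISH = exec-instr (π₁≡ refl ,≡ π₂≡ (π₂≡ (π₂≡ refl)))

-- Compiling the partial recursive functions

encode : ∀ {n} → Vec ℕ n → ℕ
encode []       = 0
encode (x ∷ xs) = ⟨ x , encode xs ⟩

compileProj : ∀ {n} → Fin n → ℕ
compileProj zero    = HEAD
compileProj (suc i) = TAIL ﹔ compileProj i

compile : ∀ {n} → Rec n → ℕ
compile* : ∀ {m n} → Vec (Rec n) m → ℕ
compile zeroᶠ       = ZERO
compile sucᶠ        = SUC
compile (proj i)    = compileProj i
compile (comp g hs) = compile* hs ﹔ compile g
compile (prec g h)  =
  (PREC-INIT ﹔ compile g ﹔ while (PREC-BODY ﹔ compile h)) ﹔ FINISH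
-- `SWAP` moves the value of `p` below the index, where the loop tests it.
compile (min p)     =
  (MIN-INIT ﹔ (compile p ﹔ SWAP) ﹔ while (MIN-BODY ﹔ compile p ﹔ SWAP)) ﹔ FINISH
compile* []       = ZERO
-- Each function consumes its argument tuple, hence the copy; the tail is evaluated first so that
-- `CONS` finds the head on top.
compile* (h ∷ hs) = DUP ﹔ compile* hs ﹔ SWAP ﹔ compile h ﹔ CONS

Runs : ∀ {n} → ℕ → Vec ℕ n → ℕ → Set
Runs c xs y = ∀ s → Exec c ⟨ encode xs , s ⟩ ⟨ y , s ⟩

runs-proj : ∀ {n} (i : Fin n) xs → Runs (compileProj i) xs (lookup xs i)
runs-proj zero    (x ∷ xs) s = exec-HEAD
runs-proj (suc i) (x ∷ xs) s = exec-seq exec-TAIL (runs-proj i xs s)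

-- The runs to a given iteration of the loop are phrased as: whatever the loop does from there,
-- the whole program does from the start.
runs-min : ∀ {n} {xs : Vec ℕ n} {c s} i {z} →
           (∀ j → j < i → ∃ λ k → Runs c (j ∷ xs) (suc k)) → Runs c (i ∷ xs) z → ∀ {w} →
           Exec (while (MIN-BODY ﹔ c ﹔ SWAP)) ⟨ i , ⟨ z , ⟨ encode xs , s ⟩ ⟩ ⟩ w →
           Exec (MIN-INIT ﹔ (c ﹔ SWAP) ﹔ while (MIN-BODY ﹔ c ﹔ SWAP)) ⟨ encode xs , s ⟩ w
runs-min zero    below at loop =
  exec-seq exec-MIN-INIT (exec-seq (exec-seq (at _) exec-SWAP) loop)
runs-min {xs = xs} (suc i) below at loop with below i ≤-refl
... | k , at-i = runs-min {xs = xs} i (λ j j<i → below j (m≤n⇒m≤1+n j<i)) at-i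
  (exec-while-loop (exec-seq exec-MIN-BODY (exec-seq (at _) exec-SWAP)) loop)

runs : ∀ {n} {p : Rec n} {xs y} → p ⟦ xs ⟧⇓ y → Runs (compile p) xs y
runs* : ∀ {m n} {hs : Vec (Rec n) m} {xs ys} →
        Pointwise (λ h y → h ⟦ xs ⟧⇓ y) hs ys → Runs (compile* hs) xs (encode ys)
-- Induction on the derivation, in the same form as `runs-min`: the recursion argument `m` stays
-- fixed while `r` counts the rounds still to come after `k`.
runs-prec : ∀ {n} {g : Rec n} {h xs k y} → prec g h ⟦ k ∷ xs ⟧⇓ y → ∀ {r m s w} → k + r ≡ m →
            Exec (while (PREC-BODY ﹔ compile h)) ⟨ y , ⟨ r , ⟨ ⟨ k , encode xs ⟩ , s ⟩ ⟩ ⟩ w →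
            Exec (PREC-INIT ﹔ compile g ﹔ while (PREC-BODY ﹔ compile h))
              ⟨ ⟨ m , encode xs ⟩ , s ⟩ w
runs-prec-total : ∀ {n} {g : Rec n} {h xs k y} → prec g h ⟦ k ∷ xs ⟧⇓ y →
                  Runs (compile (prec g h)) (k ∷ xs) y

runs zero⇓          s = exec-ZERO
runs suc⇓           s = exec-SUC
runs (proj⇓ {i = i} {xs}) s = runs-proj i xs s
runs (comp⇓ hs⇓ g⇓) s = exec-seq (runs* hs⇓ s) (runs g⇓ s)
runs (prec⇓₀ {h = h} g⇓) = runs-prec-total (prec⇓₀ {h = h} g⇓)
runs (prec⇓₊ p⇓ h⇓) = runs-prec-total (prec⇓₊ p⇓ h⇓)
runs (min⇓ {xs = xs} {y} below at) s = exec-seq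
  (runs-min {xs = xs} y (λ j j<y → let k , p⇓ = below j j<y in k , runs p⇓) (runs at) exec-while-stop)
  exec-FINISH

runs* []         s = exec-ZERO
runs* (h⇓ ∷ hs⇓) s = exec-seq exec-DUP (exec-seq (runs* hs⇓ _)
  (exec-seq exec-SWAP (exec-seq (runs h⇓ _) exec-CONS)))

runs-prec (prec⇓₀ g⇓) refl loop = exec-seq exec-PREC-INIT (exec-seq (runs g⇓ _) loop)
runs-prec {h = h} (prec⇓₊ {xs = xs} {k} p⇓ h⇓) {r} k+r≡m loop =
  runs-prec {h = h} {xs} p⇓ (trans (+-suc k r) k+r≡m)
    (exec-while-loop (exec-seq exec-PREC-BODY (runs h⇓ _)) loop)

runs-prec-total {h = h} {xs} {k} p⇓ s =
  exec-seq (runs-prec {h = h} {xs} p⇓ (+-identityʳ k) exec-while-stop) exec-FINISH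

-- The Kleene tree

-- The data are `encode (c ∷ [])` on an empty stack; `halted` below the command stops the machine
-- once `c` is done.
initial : ℕ → ℕ
initial c = ⟨ ⟨ c , halted ⟩ , ⟨ ⟨ c , 0 ⟩ , 0 ⟩ ⟩

result : ℕ → ℕ
result st = ifz (tag st) (suc (π₁ (π₂ st))) 0

-- The program π₁ j is run on its own code for π₂ j steps; the output is suc v if it has
-- returned v by then, and 0 if it is still running.
output : ℕ → ℕ
output j = result (fold (initial (π₁ j)) step (π₂ j))

output-recursive : Recursive₁ output
output-recursive j = ifz-recursive (π₁-recursive (π₁-recursive (π₁-recursive final)))
  (suc-recursive (π₁-recursive (π₂-recursive final))) (const-recursive 0)
  where
  code-recursive = π₁-recursive j
  final = fold-recursive step step-recursive
    (⟨,⟩-recursive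
      (⟨,⟩-recursive code-recursive (⟨,⟩-recursive
        (⟨,⟩-recursive (const-recursive 0) (const-recursive 0)) (const-recursive 0)))
      (⟨,⟩-recursive (⟨,⟩-recursive code-recursive (const-recursive 0)) (const-recursive 0)))
    (π₂-recursive j)

output-⟨,⟩ : ∀ c n → output ⟨ c , n ⟩ ≡ result (fold (initial c) step n)
output-⟨,⟩ c n = cong₂ (λ c n → result (fold (initial c) step n)) (π₁-⟨,⟩ c n) (π₂-⟨,⟩ c n)

-- A nonzero result forces tag 0, on which `step` is the identity.
halted-fixed : ∀ {st} → result st ≢ 0 → ∀ n → fold st step n ≡ st
halted-fixed result≢0 zero = refl
halted-fixed {st} result≢0 (suc n) rewrite halted-fixed result≢0 n with tag st
... | zero  = refl
... | suc _ = contradiction refl result≢0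

output-stable : ∀ j {n} → output j ≢ 0 → π₂ j ≤ n → output ⟨ π₁ j , n ⟩ ≡ output j
output-stable j {n} output≢0 π₂j≤n = begin
  output ⟨ π₁ j , n ⟩
    ≡⟨ output-⟨,⟩ (π₁ j) n ⟩
  result (fold start step n)
    ≡⟨ cong (λ m → result (fold start step m)) (sym (m∸n+n≡m π₂j≤n)) ⟩
  result (fold start step (n ∸ π₂ j + π₂ j))
    ≡⟨ cong result (fold-+ start step (n ∸ π₂ j)) ⟩
  result (fold (fold start step (π₂ j)) step (n ∸ π₂ j))
    ≡⟨ cong result (halted-fixed output≢0 (n ∸ π₂ j)) ⟩
  output j
    ∎
  where
  open ≡-Reasoning
  start = initial (π₁ j)

-- The witness pairs the compiled program with its running time on its own code.
output-complete : ∀ {f} (f-computable : Computable f) → ∃ λ j → output j ≡ suc (f (π₁ j))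
output-complete {f} (p , p⇓) with runs (p⇓ (compile p)) 0 halted
... | n , reaches = ⟨ compile p , n ⟩ , (begin
  output ⟨ compile p , n ⟩
    ≡⟨ output-⟨,⟩ (compile p) n ⟩
  result (fold (initial (compile p)) step n)
    ≡⟨ cong result reaches ⟩
  result ⟨ halted , ⟨ f (compile p) , 0 ⟩ ⟩
    ≡⟨ ifz-zero (π₁≡ (π₁≡ (π₁≡ refl))) ⟩
  suc (π₁ (π₂ ⟨ halted , ⟨ f (compile p) , 0 ⟩ ⟩))
    ≡⟨ cong suc (π₁≡ (π₂≡ refl)) ⟩
  suc (f (compile p))
    ≡⟨ cong (λ c → suc (f c)) (sym (π₁-⟨,⟩ (compile p) n)) ⟩
  suc (f (π₁ ⟨ compile p , n ⟩))
    ∎)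
  where open ≡-Reasoning

-- Entries are shifted by one, with 0 marking positions beyond the end of the list.
entry : List ℕ → ℕ → ℕ
entry []       _       = 0
entry (x ∷ xs) zero    = suc x
entry (x ∷ xs) (suc i) = entry xs i

entry≢0⇒< : ∀ xs {i} → entry xs i ≢ 0 → i < length xs
entry≢0⇒< []       {_}     entry≢0 = contradiction refl entry≢0
entry≢0⇒< (x ∷ xs) {zero}  entry≢0 = z<s
entry≢0⇒< (x ∷ xs) {suc i} entry≢0 = s<s (entry≢0⇒< xs entry≢0)

entry-applyUpTo : ∀ (f : ℕ → ℕ) {n i} → i < n → entry (applyUpTo f n) i ≡ suc (f i)
entry-applyUpTo f {suc n} {zero}  _         = refl
entry-applyUpTo f {suc n} {suc i} (s<s i<n) = entry-applyUpTo (λ i → f (suc i)) i<n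

entries : 2^<ω → ℕ → ℕ
entries σ = entry (map toℕ σ)

entries-applyUpTo : ∀ (f : ℕ → Fin 2) {n i} → i < n →
                    entries (applyUpTo f n) i ≡ suc (toℕ (f i))
entries-applyUpTo f {n} {i} i<n =
  trans (cong (λ xs → entry xs i) (map-applyUpTo f toℕ n)) (entry-applyUpTo (λ i → toℕ (f i)) i<n)

entries≢0⇒< : ∀ (f : ℕ → Fin 2) n {i} → entries (applyUpTo f n) i ≢ 0 → i < n
entries≢0⇒< f n {i} entry≢0 = subst (i <_) (length-applyUpTo (λ i → toℕ (f i)) n)
  (entry≢0⇒< (applyUpTo (λ i → toℕ (f i)) n)
    (subst (λ xs → entry xs i ≢ 0) (map-applyUpTo f toℕ n) entry≢0))

entries-prefix : ∀ {σ τ} → Prefix _≡_ σ τ → ∀ i → entries σ i ≢ 0 → entries τ i ≡ entries σ i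
entries-prefix []             i       entry≢0 = contradiction refl entry≢0
entries-prefix (refl ∷ σ≤τ)   zero    entry≢0 = refl
entries-prefix (refl ∷ σ≤τ)   (suc i) entry≢0 = entries-prefix σ≤τ i entry≢0

-- σ differs at e from what program e returns on e within any number of steps n for which
-- the position ⟨ e , n ⟩ exists in σ.
Tree : Pred 2^<ω 0ℓ
Tree σ = ∀ j → entries σ j ≢ 0 → output j ≢ 0 → output j ≢ entries σ (π₁ j)

tree-isBinaryTree : IsBinaryTree Tree
tree-isBinaryTree = record
  { nonempty = [] , λ j entry≢0 → contradiction refl entry≢0
  -- Agreement with a nonzero output makes the entry of `σ` at `π₁ j` nonzero, so this entry also
  -- persists in `τ`.
  ; closed   = λ { {σ} {τ} (σ≤τ , _) τ∈T j entry≢0 output≢0 output≡ →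
      τ∈T j (λ entry≡0 → entry≢0 (trans (sym (entries-prefix σ≤τ j entry≢0)) entry≡0)) output≢0
        (trans output≡ (sym (entries-prefix σ≤τ (π₁ j)
          (λ entry≡0 → output≢0 (trans output≡ entry≡0))))) }
  }

-- Outputs are shifted by one: 1 means that 0 was returned, and only then is the bit 1 needed.
other : ℕ → Fin 2
other 1 = 1F
other _ = 0F

suc-other≢ : ∀ m → m ≢ ℕ.suc (toℕ (other m))
suc-other≢ 0             ()
suc-other≢ 1             ()
suc-other≢ (suc (suc m)) ()

-- One step bound `n` serves all positions: `j < n` gives `π₂ j ≤ n`, and by `output-stable` a value
-- returned within `π₂ j` steps is still there after `n`.
avoid : ℕ → 2^<ω
avoid n = applyUpTo (λ e → other (output ⟨ e , n ⟩)) n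

avoid∈tree : ∀ n → Tree (avoid n)
avoid∈tree n j entry≢0 output≢0 output≡ = suc-other≢ (output j) (begin
  output j
    ≡⟨ output≡ ⟩
  entries (avoid n) (π₁ j)
    ≡⟨ entries-applyUpTo choice (≤-<-trans (π₁≤ j) j<n) ⟩
  suc (toℕ (other (output ⟨ π₁ j , n ⟩)))
    ≡⟨ cong (λ m → suc (toℕ (other m))) (output-stable j output≢0 (≤-trans (π₂≤ j) (<⇒≤ j<n))) ⟩
  suc (toℕ (other (output j)))
    ∎)
  where
  open ≡-Reasoning
  choice : ℕ → Fin 2
  choice e = other (output ⟨ e , n ⟩)
  j<n : j < n
  j<n = entries≢0⇒< choice n entry≢0

tree-infinite : Infinite Tree
tree-infinite σs = avoid n , avoid∈tree n , λ avoid∈σs →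
  <-irrefl refl (≤-trans (≤-reflexive (sym (length-applyUpTo (λ e → other (output ⟨ e , n ⟩)) n)))
    (All.lookup (xs≤max 0 (map length σs)) (∈-map⁺ length avoid∈σs)))
  -- Longer than every listed sequence.
  where n = suc (max 0 (map length σs))

tree-noComputableBranch : ¬ (∃ λ f → ComputableBranch Tree f)
tree-noComputableBranch (f , branch , computable) with output-complete computable
-- A segment of length `suc j` contains position `j`, and position `π₁ j` because `π₁ j ≤ j`; there
-- the branch agrees with the output.
... | j , output≡ = branch (suc j) j
  (λ entry≡0 → 1+n≢0 (trans (sym (entries-applyUpTo f {suc j} ≤-refl)) entry≡0))
  (λ output≡0 → 1+n≢0 (trans (sym output≡) output≡0))
  (trans output≡ (sym (entries-applyUpTo f (s≤s (π₁≤ j)))))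

-- Computability of the tree

codeTail codeHead : ℕ → ℕ
codeTail n = ifz n 0 (π₂ (pred n))
codeHead n = ifz n 0 (suc (π₁ (pred n)))

-- Both `codeTail` and `codeHead` send 0, the code of the empty list, to 0, so reading past the end
-- yields 0 as for `entry`.
codeEntry : ℕ → ℕ → ℕ
codeEntry n i = codeHead (fold n codeTail i)

codeTail-recursive : Recursive₁ codeTail
codeTail-recursive n = ifz-recursive n (const-recursive 0) (π₂-recursive (pred-recursive n))

codeEntry-recursive : Recursive₂ codeEntry
codeEntry-recursive n i =
  ifz-recursive rest′ (const-recursive 0) (suc-recursive (π₁-recursive (pred-recursive rest′)))
  where rest′ = fold-recursive codeTail codeTail-recursive n i

codeTail-∷ : ∀ x xs → codeTail (code (x ∷ xs)) ≡ code xs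
codeTail-∷ x xs = π₂≡ (sym (⟨,⟩≡pair x (code xs)))

codeHead-∷ : ∀ x xs → codeHead (code (x ∷ xs)) ≡ suc x
codeHead-∷ x xs = cong suc (π₁≡ (sym (⟨,⟩≡pair x (code xs))))

fold-suc : ∀ (s : ℕ → ℕ) z n → fold z s (suc n) ≡ fold (s z) s n
fold-suc s z zero    = refl
fold-suc s z (suc n) = cong s (fold-suc s z n)

codeEntry-code : ∀ xs i → codeEntry (code xs) i ≡ entry xs i
codeEntry-code []       zero    = refl
codeEntry-code []       (suc i) =
  trans (cong codeHead (fold-suc codeTail 0 i)) (codeEntry-code [] i)
codeEntry-code (x ∷ xs) zero    = codeHead-∷ x xs
codeEntry-code (x ∷ xs) (suc i) = trans (cong codeHead (fold-suc codeTail _ i))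
  (trans (cong (λ n → codeEntry n i) (codeTail-∷ x xs)) (codeEntry-code xs i))

length≤code : ∀ xs → length xs ≤ code xs
length≤code []       = z≤n
length≤code (x ∷ xs) = s≤s (≤-trans (length≤code xs) (m≤n+m (code xs) _))

code-surjective : ∀ n → ∃ λ xs → code xs ≡ n
code-surjective = <-rec _ λ where
  zero    rec → [] , refl
  (suc n) rec → let xs , code≡ = rec (s≤s (π₂≤ n)) in π₁ n ∷ xs ,
    cong suc (trans (cong (pair (π₁ n)) code≡) (trans (sym (⟨,⟩≡pair _ (π₂ n))) (⟨π₁,π₂⟩ n)))

binary : ∀ xs → (∀ i → entry xs i ≤ 2) → ∃ λ (σ : 2^<ω) → map toℕ σ ≡ xs
binary []       _      = [] , refl
binary (x ∷ xs) bounded with binary xs (λ i → bounded (suc i)) | bounded 0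
binary (0 ∷ xs)           _ | σ , refl | _ = 0F ∷ σ , refl
binary (1 ∷ xs)           _ | σ , refl | _ = 1F ∷ σ , refl
binary (suc (suc x) ∷ xs) _ | _        | s≤s (s≤s ())

-- Numerical negation of the tree condition at one position; the sum of the two truncated
-- differences is the distance between `b` and `c`.
conflict : ℕ → ℕ → ℕ → ℕ
conflict a b c = ifz a 0 (ifz b 0 (1 ∸ ((b ∸ c) + (c ∸ b))))

conflict≡0⁺ : ∀ a b c → (a ≢ 0 → b ≢ 0 → b ≢ c) → conflict a b c ≡ 0
conflict≡0⁺ zero    b       c _   = refl
conflict≡0⁺ (suc a) zero    c _   = refl
conflict≡0⁺ (suc a) (suc b) c b≢c with (suc b ∸ c) + (c ∸ suc b) in eq
... | suc d = 0∸n≡0 d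
... | zero  = contradiction
  (≤-antisym (m∸n≡0⇒m≤n (m+n≡0⇒m≡0 _ eq)) (m∸n≡0⇒m≤n (m+n≡0⇒n≡0 (suc b ∸ c) eq)))
  (b≢c 1+n≢0 1+n≢0)

conflict≡0⁻ : ∀ a b c → conflict a b c ≡ 0 → a ≢ 0 → b ≢ 0 → b ≢ c
conflict≡0⁻ zero    b       c eq a≢0 b≢0 _ = a≢0 refl
conflict≡0⁻ (suc a) zero    c eq a≢0 b≢0 _ = b≢0 refl
conflict≡0⁻ (suc a) (suc b) c eq a≢0 b≢0 refl rewrite n∸n≡0 b with () ← eq

-- The first summand detects an entry that is not a bit (entries are shifted, hence the 2), the
-- second a violation of the tree condition.
fault : ℕ → ℕ → ℕ
fault n j = (codeEntry n j ∸ 2) + conflict (codeEntry n j) (output j) (codeEntry n (π₁ j))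

fault-recursive : Recursive₂ fault
fault-recursive n j = +-recursive (∸-recursive entry-recursive (const-recursive 2))
  (ifz-recursive entry-recursive (const-recursive 0)
    (ifz-recursive out-recursive (const-recursive 0)
      (∸-recursive (const-recursive 1)
        (+-recursive (∸-recursive out-recursive other-recursive)
          (∸-recursive other-recursive out-recursive)))))
  where
  entry-recursive = codeEntry-recursive n j
  out-recursive   = output-recursive j
  other-recursive = codeEntry-recursive n (π₁-recursive j)

sum≡0⁻ : ∀ f n → sum (applyDownFrom f n) ≡ 0 → ∀ {i} → i < n → f i ≡ 0
sum≡0⁻ f (suc n) eq {i} i<1+n with i ≟ n
... | yes refl = m+n≡0⇒m≡0 (f n) eq
... | no  i≢n  = sum≡0⁻ f n (m+n≡0⇒n≡0 (f n) eq) (≤∧≢⇒< (s≤s⁻¹ i<1+n) i≢n)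

sum≡0⁺ : ∀ f n → (∀ i → f i ≡ 0) → sum (applyDownFrom f n) ≡ 0
sum≡0⁺ f zero    f≡0 = refl
sum≡0⁺ f (suc n) f≡0 = cong₂ _+_ (f≡0 n) (sum≡0⁺ f n f≡0)

entries≤2 : ∀ σ i → entries σ i ≤ 2
entries≤2 []       i       = z≤n
entries≤2 (0F ∷ σ) zero    = s≤s z≤n
entries≤2 (1F ∷ σ) zero    = ≤-refl
entries≤2 (_ ∷ σ)  (suc i) = entries≤2 σ i

-- The bound `n` suffices because a list is no longer than its code.
faults : ℕ → ℕ
faults n = sum (applyDownFrom (fault n) n)

faults≡0⁺ : ∀ {n} → n ∈ asSubsetOfℕ Tree → faults n ≡ 0
faults≡0⁺ (σ , σ∈T , refl) = sum≡0⁺ (fault _) (code (map toℕ σ)) λ j →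
  cong₂ _+_
    (m≤n⇒m∸n≡0 (subst (_≤ 2) (sym (codeEntry-code _ j)) (entries≤2 σ j)))
    (trans (cong₂ (λ a c → conflict a (output j) c)
        (codeEntry-code _ j) (codeEntry-code _ (π₁ j)))
      (conflict≡0⁺ _ (output j) _ (σ∈T j)))

faults≡0⁻ : ∀ n → faults n ≡ 0 → n ∈ asSubsetOfℕ Tree
faults≡0⁻ n faults≡0 with code-surjective n
... | xs , refl = decode (binary xs bounded)
  where
  fault≡0 : ∀ {j} → entry xs j ≢ 0 →
            (entry xs j ∸ 2) + conflict (entry xs j) (output j) (entry xs (π₁ j)) ≡ 0
  fault≡0 {j} entry≢0 = trans
    (cong₂ (λ a c → (a ∸ 2) + conflict a (output j) c)
      (sym (codeEntry-code xs j)) (sym (codeEntry-code xs (π₁ j))))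
    (sum≡0⁻ (fault (code xs)) (code xs) faults≡0 (≤-trans (entry≢0⇒< xs entry≢0) (length≤code xs)))
  bounded : ∀ j → entry xs j ≤ 2
  bounded j with entry xs j ≟ 0
  ... | yes entry≡0 = subst (_≤ 2) (sym entry≡0) z≤n
  ... | no  entry≢0 = m∸n≡0⇒m≤n (m+n≡0⇒m≡0 _ (fault≡0 entry≢0))
  decode : (∃ λ (σ : 2^<ω) → map toℕ σ ≡ xs) → code xs ∈ asSubsetOfℕ Tree
  decode (σ , refl) = σ , (λ j entry≢0 →
    conflict≡0⁻ _ (output j) _ (m+n≡0⇒n≡0 (entries σ j ∸ 2) (fault≡0 entry≢0)) entry≢0) , refl

tree-computable : ComputableTree Tree
tree-computable = (λ n → 1 ∸ faults n) , characteristic ,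
  (let p , p⇓ = recursive in p , λ n → p⇓ (n ∷ []))
  where
  characteristic : IsCharacteristic (λ n → 1 ∸ faults n) (asSubsetOfℕ Tree)
  characteristic n with faults n in eq
  ... | zero  = inj₁ (faults≡0⁻ n eq , refl)
  ... | suc k = inj₂ ((λ n∈T → 1+n≢0 (trans (sym eq) (faults≡0⁺ n∈T))) , 0∸n≡0 k)
  recursive : Recursive {1} (λ xs → 1 ∸ faults (lookup xs 0F))
  recursive = ∸-recursive (const-recursive 1) (sum-recursive fault fault-recursive (var 0F) (var 0F))

theorem5p2p1 : ∃ λ (T : Pred 2^<ω 0ℓ) →
    IsBinaryTree T × Infinite T × ComputableTree T × ¬ (∃ λ f → ComputableBranch T f)
theorem5p2p1 = Tree , tree-isBinaryTree , tree-infinite , tree-computable , tree-noComputableBranch
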